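{- Let $(G;+)$ be a commutative groupoid and let $M, M'$ be multisets of cardinality $4$ over $G$. Then the deck of $M$ equals the deck of $M'$ if and only if one of the following holds: (i) $M = M'$; (ii) $M = \langle r,s,t,u\rangle$ and $M' = \langle r,s,t,v\rangle$ for some $r,s,t,u,v \in G$ satisfying $x+u = v$ and $x + v = u$ for all $x \in \{r,s,t\}$, and $r+s = s$, $s+t = t$, $t+r = r$.
   Context: A (finite) multiset $M$ over a set $X$ is a function $\mathbf{1}_M \colon X \to \mathbb{N}$ with finite support; $|M| = \sum_x \mathbf{1}_M(x)$ is its cardinality. Multiset sum $\uplus$ adds multiplicities; the difference $M \setminus M'$ has multiplicities $\max(\mathbf{1}_M(x)-\mathbf{1}_{M'}(x),0)$. $\langle x_1,\dots,x_k\rangle$ denotes the multiset in which each element occurs as often as it appears in the list. A commutative groupoid is a set $G$ with a commutative binary operation $+$ (not necessarily associative). Cards and deck: for a multiset $M$ of cardinality $n \geq 2$ over $G$, fix $(m_1,\dots,m_n) \in G^n$ with $M = \langle m_1,\dots,m_n\rangle$; for $I = \{i,j\}$, $1 \le i<j \le n$, the card $M_I$ is $M \setminus \langle m_i, m_j\rangle \uplus \langle m_i + m_j\rangle$. The deck of $M$ is the multiset $\langle M_I : I \rangle$ of all $\binom{n}{2}$ cards (independent of the chosen tuple). -}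

module Defs where

open import Algebra.Bundles using (CommutativeMagma)
open import Data.Fin.Base using (Fin; _<_)
open import Data.Fin.Properties using (_≟_; _<?_)
open import Data.List.Base using (List; _∷_; length; lookup; map; filter; allFin; cartesianProduct)
open import Data.List.Membership.Propositional using (_∈_)
open import Data.List.Membership.Propositional.Properties using (∈-allFin; ∈-filter⁺)
open import Data.List.Properties using (filter-all; filter-accept; filter-reject; map-tabulate; tabulate-lookup)
import Data.List.Relation.Binary.Permutation.Propositional as Perm
import Data.List.Relation.Binary.Permutation.Propositional.Properties as Permₚ
import Data.List.Relation.Binary.Permutation.Setoid as SetoidPermutation
import Data.List.Relation.Unary.All as All
open import Data.List.Relation.Unary.AllPairs using (_∷_)
open import Data.List.Relation.Unary.Any using (here; there)
open import Data.List.Relation.Unary.Unique.Propositional using (Unique)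
open import Data.List.Relation.Unary.Unique.Propositional.Properties using (allFin⁺; filter⁺)
open import Data.Product.Base using (_×_; uncurry)
open import Function.Base using (id; _∘_)
open import Level using (_⊔_)
open import Relation.Binary.Bundles using (Setoid)
open import Relation.Binary.PropositionalEquality using (_≡_; _≢_; refl; sym; trans; subst)
open import Relation.Nullary.Decidable using (¬?)

-- A finite multiset is represented by a list of its elements, each written as
-- often as its multiplicity, and equality of multisets is permutation up to the
-- equality of the underlying setoid.  The list is the ⟨x₁,…,xₖ⟩ notation, its
-- length is the cardinality and _++_ is the multiset sum.  Multiplicity
-- functions into ℕ would force the underlying equality to be decidable.
MultisetSetoid : ∀ {a ℓ} → Setoid a ℓ → Setoid a (a ⊔ ℓ)
MultisetSetoid S = SetoidPermutation.↭-setoid S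

without : ∀ {n} → Fin n → List (Fin n) → List (Fin n)
without k = filter (λ l → ¬? (l ≟ k))

indexPairs : ∀ n → List (Fin n × Fin n)
indexPairs n = filter (uncurry _<?_) (cartesianProduct (allFin n) (allFin n))

module Deck {c ℓ} (G : CommutativeMagma c ℓ) where

  open CommutativeMagma G public using (_≈_)
    renaming (Carrier to ∣G∣; _∙_ to infixl 6 _+_)

  private
    multisets  = MultisetSetoid (CommutativeMagma.setoid G)
    deckSetoid = MultisetSetoid multisets

  open Setoid multisets  public using () renaming (Carrier to Multiset; _≈_ to _≈ₘ_)
  open Setoid deckSetoid public using () renaming (Carrier to MultisetOfMs; _≈_ to _≈ₘₘ_)

  -- M ∖ ⟨mᵢ , mⱼ⟩, where M = ⟨m₁,…,mₙ⟩: for i ≢ j this is the multiset of the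
  -- entries at the other positions (see rest-↭), so that no decidable equality
  -- on G is needed.
  rest : (M : Multiset) → Fin (length M) → Fin (length M) → Multiset
  rest M i j = map (lookup M) (without j (without i (allFin (length M))))

  card : (M : Multiset) → Fin (length M) → Fin (length M) → Multiset
  card M i j = (lookup M i + lookup M j) ∷ rest M i j

  deck : Multiset → MultisetOfMs
  deck M = map (uncurry (card M)) (indexPairs (length M))

without-↭ : ∀ {n} {k : Fin n} {ks} → Unique ks → k ∈ ks → ks Perm.↭ k ∷ without k ks
without-↭ {k = k} {.k ∷ ks} (k∉ks ∷ _) (here refl)
  rewrite filter-reject (λ l → ¬? (l ≟ k)) {xs = ks} (λ k≢k → k≢k refl)
        | filter-all (λ l → ¬? (l ≟ k)) (All.map (_∘ sym) k∉ks) = Perm.refl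
without-↭ {k = k} {l ∷ ks} (l∉ks ∷ ks!) (there k∈ks)
  rewrite filter-accept (λ l → ¬? (l ≟ k)) {xs = ks} (All.lookup l∉ks k∈ks) =
  Perm.trans (Perm.prep l (without-↭ ks! k∈ks)) (Perm.swap l k Perm.refl)

module _ {c ℓ} (G : CommutativeMagma c ℓ) where

  open Deck G

  rest-↭ : ∀ M {i j} → i ≢ j → M Perm.↭ lookup M i ∷ lookup M j ∷ rest M i j
  rest-↭ M {i} {j} i≢j = subst (Perm._↭ (lookup M i ∷ lookup M j ∷ rest M i j)) map-lookup (Permₚ.map⁺ (lookup M) indices)
    where
    n = length M

    map-lookup : map (lookup M) (allFin n) ≡ M
    map-lookup = trans (map-tabulate id (lookup M)) (tabulate-lookup M)

    indices : allFin n Perm.↭ i ∷ j ∷ without j (without i (allFin n))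
    indices = Perm.trans (without-↭ (allFin⁺ n) (∈-allFin i))
      (Perm.prep i (without-↭ (filter⁺ (λ l → ¬? (l ≟ i)) (allFin⁺ n))
        (∈-filter⁺ (λ l → ¬? (l ≟ i)) (∈-allFin j) (i≢j ∘ sym))))

{-# OPTIONS --safe #-}

-- Counting the entries of all cards gives 3M ⊎ S = 3M′ ⊎ S′, where S and S′ are
-- the six pairwise sums.  Split off the common part C of M and M′, so that
-- M = D ⊎ C and M′ = D′ ⊎ C with D, D′ disjoint; then 3D ⊆ S′ and 3D′ ⊆ S, and
-- hence |D| ≤ 2.  If |D| = 2 then S′ = 3D and S = 3D′, but the sum of the two
-- elements of C lies in both S and S′.  If D = ⟨u⟩ and D′ = ⟨v⟩ then x + u = v
-- and x + v = u for all x in C = ⟨r,s,t⟩, and equality of the decks reads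
-- v·B ⊎ u·A = u·B ⊎ v·A, where u·_ adds u to each member,
-- A = ⟨⟨r+s,t⟩,⟨r+t,s⟩,⟨s+t,r⟩⟩ and B = ⟨⟨s,t⟩,⟨r,t⟩,⟨r,s⟩⟩.  As u ≠ v this
-- forces A = B, from which a cyclic order of r, s, t can be read off.
--
-- The argument is classical, while equality in G need not be decidable.  Since
-- the goal Q is all that is ever concluded from an inequality, negation is read
-- as "implies Q", and relative to that reading excluded middle is provable.

module Submission where

open import Defs
open import Algebra.Bundles using (CommutativeMagma)
import Algebra.Solver.CommutativeMonoid as CommutativeMonoidSolver
open import Data.Fin.Base using (zero; suc)
open import Data.List.Base using (List; []; _∷_; _++_; _ʳ++_; concat; length; map)
open import Data.List.Properties using (length-map; length-++; map-++; length-ʳ++)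
import Data.List.Membership.Setoid as Membership
import Data.List.Membership.Setoid.Properties as Membershipₚ
open import Data.List.Relation.Binary.Permutation.Homogeneous using (refl; prep; swap; trans)
import Data.List.Relation.Binary.Equality.Setoid as Equality
import Data.List.Relation.Binary.Permutation.Setoid as Permutation
import Data.List.Relation.Binary.Permutation.Setoid.Properties as Permutationₚ
open import Data.List.Relation.Binary.Pointwise using ([]; _∷_)
open import Data.List.Relation.Unary.All using (All; []; _∷_)
import Data.List.Relation.Unary.All as All
open import Data.List.Relation.Unary.Any using (here; there)
open import Data.Nat.Base using () renaming (_+_ to _+ℕ_)
open import Data.Nat.Properties using (m+1+n≢m; +-comm; +-cancelʳ-≡; suc-injective)
open import Data.Product.Base using (_×_; ∃-syntax; _,_; proj₁; proj₂)
open import Data.Sum.Base using (_⊎_; inj₁; inj₂)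
open import Function.Base using (_∘_; const)
open import Function.Bundles using (_⇔_; mk⇔)
open import Level using (Level)
open import Relation.Binary.Bundles using (Setoid)
open import Relation.Binary.PropositionalEquality as ≡ using (_≡_)
open import Relation.Nullary.Negation using (contradiction)

private variable
  a ℓ q : Level
  Q : Set q

-- Common parts and cancellation of multisets

module _ (S : Setoid a ℓ) where

  open Setoid S using (_≈_) renaming (Carrier to A; refl to ≈-refl; sym to ≈-sym)
  open Membership S using (_∈_)
  open Membershipₚ using (∈-resp-≈; ∈-++⁺ˡ; ∈-++⁻)
  open Permutation S hiding (refl; prep; swap; trans)
  open Permutationₚ S

  private variable
    x y : A
    X Y U V W : List A

  ∈⇒↭ : x ∈ X → ∃[ Y ] X ↭ x ∷ Y
  ∈⇒↭ (here x≈y) = _ , prep (≈-sym x≈y) ↭-refl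
  ∈⇒↭ (there {y} x∈X) with Y , X↭ ← ∈⇒↭ x∈X =
    y ∷ Y , trans (↭-prep y X↭) (↭-swap y _ ↭-refl)

  [x]↭[y]⇒x≈y : x ∷ [] ↭ y ∷ [] → x ≈ y
  [x]↭[y]⇒x≈y p with here x≈y ← ∈-resp-↭ p (here ≈-refl) = x≈y

  ++-absorb : ∀ W → length U ≡ length X → U ↭ X ++ W → W ≡ []
  ++-absorb [] _ _ = ≡.refl
  ++-absorb {X = X} (_ ∷ _) eq p = contradiction
    (≡.trans (≡.sym (length-++ X)) (≡.trans (≡.sym (xs↭ys⇒|xs|≡|ys| p)) eq))
    (m+1+n≢m (length X))

  -- `Q` takes the place of falsity, so disjointness can be assumed without deciding equality.
  Disjoint : Set q → List A → List A → Set _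
  Disjoint Q X Y = ∀ {x} → x ∈ X → x ∈ Y → Q

  -- Excluded middle for a ∈ Y relative to Q: a ∉ Y is assumed first, and the
  -- other case is entered when that assumption is applied to a proof of a ∈ Y.
  commonPart : ∀ X Y →
    (∀ C D E → X ↭ D ++ C → Y ↭ E ++ C → Disjoint Q D E → Q) → Q
  commonPart []      Y k = k [] [] Y ↭-refl (↭-sym (++-identityʳ Y)) λ ()
  commonPart {Q = Q} (a ∷ X) Y k = absent λ a∈Y → present (∈⇒↭ a∈Y)
    where
    present : ∃[ Z ] Y ↭ a ∷ Z → Q
    present (Z , Y↭) = commonPart X Z λ C D E p r d →
      k (a ∷ C) D E
        (trans (↭-prep a p) (↭-sym (↭-shift D C)))
        (trans Y↭ (trans (↭-prep a r) (↭-sym (↭-shift E C)))) d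

    absent : (a ∈ Y → Q) → Q
    absent a∉Y = commonPart X Y λ C D E p r d →
      k C (a ∷ D) E (↭-prep a p) r λ where
        (here x≈a)  x∈E → a∉Y (∈-resp-↭ (↭-sym r) (∈-++⁺ˡ S (∈-resp-≈ S x≈a x∈E)))
        (there x∈D) x∈E → d x∈D x∈E

  -- Each element of `X` reappears in `Y ++ V`; lying in `Y` would give `Q`, so it is found in `V`
  -- and struck from both sides. What remains of `V` at the end is `W`.
  disjoint-split : ∀ X → Disjoint Q X Y → X ++ U ↭ Y ++ V →
    (∀ W → V ↭ X ++ W → U ↭ Y ++ W → Q) → Q
  disjoint-split {V = V} [] d p k = k V ↭-refl p
  disjoint-split {Y = Y} (x ∷ X) d p k with ∈-++⁻ S Y (∈-resp-↭ p (here ≈-refl))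
  ... | inj₁ x∈Y = d (here ≈-refl) x∈Y
  ... | inj₂ x∈V with V′ , V↭ ← ∈⇒↭ x∈V =
    disjoint-split X (d ∘ there)
      (drop-∷ (trans p (trans (++⁺ˡ Y V↭) (↭-shift Y V′))))
      λ W V′↭ U↭ → k W (trans V↭ (↭-prep x V′↭)) U↭

  triple : List A → List A
  triple X = X ++ X ++ X

  ∈-triple⁻ : ∀ X → x ∈ triple X → x ∈ X
  ∈-triple⁻ X x∈ with ∈-++⁻ S X x∈
  ... | inj₁ x∈X = x∈X
  ... | inj₂ x∈′ with ∈-++⁻ S X x∈′
  ...   | inj₁ x∈X = x∈X
  ...   | inj₂ x∈X = x∈X

  private module Solver = CommutativeMonoidSolver ++-commutativeMonoid
  open Solver using (_⊕_; _⊜_)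

  triple-cancel : ∀ X Y C → triple (X ++ C) ++ U ↭ triple (Y ++ C) ++ V →
    triple X ++ U ↭ triple Y ++ V
  triple-cancel {U = U} {V = V} X Y C p = dropMiddle {vs = triple C} (triple X) (triple Y)
    (trans (↭-sym (regroup X U)) (trans p (regroup Y V)))
    where
    regroup : ∀ X U → triple (X ++ C) ++ U ↭ triple X ++ triple C ++ U
    regroup X U = Solver.solve 3 (λ x c u →
      ((x ⊕ c) ⊕ (x ⊕ c) ⊕ (x ⊕ c)) ⊕ u ⊜ (x ⊕ x ⊕ x) ⊕ (c ⊕ c ⊕ c) ⊕ u)
      ↭-refl X C U

-- Adding one element to every member of a multiset of multisets

module _ (S : Setoid a ℓ) where

  open Setoid S using (_≈_) renaming (Carrier to A; refl to ≈-refl; sym to ≈-sym)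
  open Permutation S hiding (refl; prep; swap; trans)
  open Permutationₚ S
  private
    module Ms = Permutation (MultisetSetoid S)
    module Msₚ = Permutationₚ (MultisetSetoid S)
    module MsSolver = CommutativeMonoidSolver Msₚ.++-commutativeMonoid

  private variable
    u v : A
    𝓐 𝓑 𝓒 𝓓 𝓔 : List (List A)

  map-∷⁺ : ∀ u → 𝓐 Ms.↭ 𝓑 → map (u ∷_) 𝓐 Ms.↭ map (u ∷_) 𝓑
  map-∷⁺ u = Msₚ.map⁺ (MultisetSetoid S) (↭-prep u)

  concat⁺ : 𝓐 Ms.↭ 𝓑 → concat 𝓐 ↭ concat 𝓑
  concat⁺ = Msₚ.foldr-commMonoid ++-isCommutativeMonoid

  concat-map-∷ : ∀ u 𝓐 → concat (map (u ∷_) 𝓐) ↭ map (const u) 𝓐 ++ concat 𝓐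
  concat-map-∷ u []      = ↭-refl
  concat-map-∷ u (X ∷ 𝓐) = ↭-prep u (trans (++⁺ˡ X (concat-map-∷ u 𝓐)) (shifts X (map (const u) 𝓐)))

  -- If `𝓐` is nonempty, equal cardinalities make `𝓒` empty; flattening both sides and cancelling
  -- `concat 𝓐` then leaves copies of `u` against copies of `v`.
  map-∷-absorb : ∀ 𝓐 → map (v ∷_) 𝓐 Ms.↭ map (u ∷_) 𝓐 ++ 𝓒 → (u ≈ v → Q) → (𝓐 ≡ [] → Q) → Q
  map-∷-absorb [] _ _ k = k ≡.refl
  map-∷-absorb {v = v} {u} {𝓒 = 𝓒} 𝓐@(_ ∷ _) p u≉v _
    with ≡.refl ← ++-absorb (MultisetSetoid S) 𝓒
           (≡.trans (length-map (v ∷_) 𝓐) (≡.sym (length-map (u ∷_) 𝓐))) p =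
    u≉v (∈-map-const⁻ 𝓐 (∈-resp-↭ us↭vs (here ≈-refl)))
    where
    open Membership S using (_∈_)

    us↭vs : map (const u) 𝓐 ↭ map (const v) 𝓐
    us↭vs = trans (↭-sym (++-identityʳ _)) (trans (dropMiddle (map (const u) 𝓐) (map (const v) 𝓐)
      (trans (++⁺ˡ (map (const u) 𝓐) (++-identityʳ (concat 𝓐)))
      (trans (↭-sym (concat-map-∷ u 𝓐))
      (trans (concat⁺ (Ms.↭-sym (Ms.↭-trans p (Msₚ.++-identityʳ (map (u ∷_) 𝓐)))))
      (trans (concat-map-∷ v 𝓐)
             (++⁺ˡ (map (const v) 𝓐) (↭-sym (++-identityʳ (concat 𝓐)))))))))
      (++-identityʳ _))

    ∈-map-const⁻ : ∀ 𝓐 → u ∈ map (const v) 𝓐 → u ≈ v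
    ∈-map-const⁻ (_ ∷ _) (here u≈v) = u≈v
    ∈-map-const⁻ (_ ∷ 𝓐) (there u∈) = ∈-map-const⁻ 𝓐 u∈

  -- This is cancellation of u − v in (u − v)(A − B) = 0.
  exchange-cancel : ∀ 𝓐 𝓑 → (u ≈ v → Q) →
    map (u ∷_) 𝓐 ++ map (v ∷_) 𝓑 Ms.↭ map (u ∷_) 𝓑 ++ map (v ∷_) 𝓐 →
    (𝓐 Ms.↭ 𝓑 → Q) → Q
  exchange-cancel {u = u} {v} 𝓐 𝓑 u≉v p k =
    commonPart (MultisetSetoid S) 𝓐 𝓑 λ 𝓒 𝓓 𝓔 𝓐↭ 𝓑↭ disjoint →
    -- Without the common part the hypothesis reads u·𝓓 ⊎ v·𝓔 = u·𝓔 ⊎ v·𝓓. Since u·𝓓 and u·𝓔 are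
    -- disjoint, u·𝓓 lies in v·𝓓 and u·𝓔 in v·𝓔, so both `𝓓` and `𝓔` are empty.
    disjoint-split (MultisetSetoid S) (map (u ∷_) 𝓓) (disjoint-map disjoint)
      (Msₚ.dropMiddle {vs = map (u ∷_) 𝓒 ++ map (v ∷_) 𝓒} (map (u ∷_) 𝓓) (map (u ∷_) 𝓔)
        (trans (Ms.↭-sym (regroup 𝓒 𝓓 𝓔 𝓐↭ 𝓑↭)) (trans p (regroup 𝓒 𝓔 𝓓 𝓑↭ 𝓐↭))))
    λ _ v𝓓↭ v𝓔↭ →
    map-∷-absorb 𝓓 v𝓓↭ u≉v λ 𝓓≡[] →
    map-∷-absorb 𝓔 v𝓔↭ u≉v λ 𝓔≡[] →
    k (trans 𝓐↭ (trans (Ms.↭-reflexive (≡.cong (_++ 𝓒) (≡.trans 𝓓≡[] (≡.sym 𝓔≡[])))) (Ms.↭-sym 𝓑↭)))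
    where
    open MsSolver using (_⊕_; _⊜_)

    disjoint-map : Disjoint (MultisetSetoid S) Q 𝓓 𝓔 →
      Disjoint (MultisetSetoid S) Q (map (u ∷_) 𝓓) (map (u ∷_) 𝓔)
    disjoint-map d X∈ X∈′ with Membershipₚ.∈-map⁻ (MultisetSetoid S) (MultisetSetoid S) X∈
                             | Membershipₚ.∈-map⁻ (MultisetSetoid S) (MultisetSetoid S) X∈′
    ... | Y , Y∈ , X↭Y | Z , Z∈ , X↭Z =
      d Y∈ (Membershipₚ.∈-resp-≈ (MultisetSetoid S) (drop-∷ (trans (↭-sym X↭Z) X↭Y)) Z∈)

    regroup : ∀ {𝓐 𝓑} 𝓒 𝓓 𝓔 → 𝓐 Ms.↭ 𝓓 ++ 𝓒 → 𝓑 Ms.↭ 𝓔 ++ 𝓒 →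
      map (u ∷_) 𝓐 ++ map (v ∷_) 𝓑 Ms.↭
      map (u ∷_) 𝓓 ++ (map (u ∷_) 𝓒 ++ map (v ∷_) 𝓒) ++ map (v ∷_) 𝓔
    regroup 𝓒 𝓓 𝓔 𝓐↭ 𝓑↭ = trans
      (Msₚ.++⁺ (trans (map-∷⁺ u 𝓐↭) (Ms.↭-reflexive (map-++ (u ∷_) 𝓓 𝓒)))
               (trans (map-∷⁺ v 𝓑↭) (Ms.↭-reflexive (map-++ (v ∷_) 𝓔 𝓒))))
      (MsSolver.solve 4 (λ d c e c′ → (d ⊕ c) ⊕ (e ⊕ c′) ⊜ d ⊕ (c ⊕ c′) ⊕ e) Ms.↭-refl
        (map (u ∷_) 𝓓) (map (u ∷_) 𝓒) (map (v ∷_) 𝓔) (map (v ∷_) 𝓒))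

module _ {c ℓ} (G : CommutativeMagma c ℓ) where

  open Deck G
  open CommutativeMagma G using (setoid; ∙-cong; comm)
    renaming (refl to ≈-refl; sym to ≈-sym; trans to ≈-trans)
  open Equality setoid using (_≋_; ≋-refl; ʳ++⁺)
  open Membership setoid using (_∈_)
  open Permutation setoid using (_↭_; ↭-refl; ↭-sym; ↭-prep; ↭-swap)
  open Permutationₚ setoid
  private
    multisets = MultisetSetoid setoid
    module Ms = Permutation multisets
    module Msₚ = Permutationₚ multisets
    module Solver = CommutativeMonoidSolver ++-commutativeMonoid

  private variable
    r s t u v x y z : ∣G∣
    X Y : Multiset

  -- Invariance of the deck under reordering

  deck-resp-≋ : length X ≡ 4 → X ≋ Y → deck X ≈ₘₘ deck Y
  deck-resp-≋ {_ ∷ _ ∷ _ ∷ _ ∷ []} _ (a ∷ b ∷ c ∷ d ∷ []) = refl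
    ( refl (∙-cong a b ∷ c ∷ d ∷ []) ∷ refl (∙-cong a c ∷ b ∷ d ∷ [])
    ∷ refl (∙-cong a d ∷ b ∷ c ∷ []) ∷ refl (∙-cong b c ∷ a ∷ d ∷ [])
    ∷ refl (∙-cong b d ∷ a ∷ c ∷ []) ∷ refl (∙-cong c d ∷ a ∷ b ∷ []) ∷ [])

  -- Transposing neighbours permutes the six cards and commutes one sum. The length equation leaves
  -- three positions, one per clause.
  deck-swap : ∀ x y X Z → length X +ℕ length Z ≡ 2 →
    deck (Z ʳ++ x ∷ y ∷ X) ≈ₘₘ deck (Z ʳ++ y ∷ x ∷ X)
  deck-swap a b (c ∷ d ∷ []) [] _ = prep (prep (comm a b) ↭-refl)
    (trans (Msₚ.shifts (card M i₀ i₂ ∷ card M i₀ i₃ ∷ []) (card M i₁ i₂ ∷ card M i₁ i₃ ∷ []))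
           (Msₚ.++⁺ˡ (card M i₁ i₂ ∷ card M i₁ i₃ ∷ card M i₀ i₂ ∷ card M i₀ i₃ ∷ [])
             (prep (↭-prep (c + d) (↭-swap a b ↭-refl)) Ms.↭-refl)))
    where
    M = a ∷ b ∷ c ∷ d ∷ []
    i₀ = zero
    i₁ = suc zero
    i₂ = suc (suc zero)
    i₃ = suc (suc (suc zero))
  deck-swap b c (d ∷ []) (a ∷ []) _ =
    Ms.↭-swap _ _ (prep (↭-prep (a + d) (↭-swap b c ↭-refl)) (prep (prep (comm b c) ↭-refl)
      (Ms.↭-swap _ _ Ms.↭-refl)))
  deck-swap c d [] (b ∷ a ∷ []) _ =
    prep (↭-prep (a + b) (↭-swap c d ↭-refl)) (Ms.↭-swap _ _ (Ms.↭-swap _ _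
      (prep (prep (comm c d) ↭-refl) Ms.↭-refl)))

  length-ʳ++-↭ : ∀ Z → X ↭ Y → length (Z ʳ++ X) ≡ length (Z ʳ++ Y)
  length-ʳ++-↭ Z p = ≡.trans (length-ʳ++ Z)
    (≡.trans (≡.cong (length Z +ℕ_) (xs↭ys⇒|xs|≡|ys| p)) (≡.sym (length-ʳ++ Z)))

  -- The deck depends on the whole list, so induction under `prep` must remember the entries already
  -- passed; `Z` holds them, last one first.
  deck-resp-ʳ++ : ∀ Z → length (Z ʳ++ X) ≡ 4 → X ↭ Y → deck (Z ʳ++ X) ≈ₘₘ deck (Z ʳ++ Y)
  deck-resp-ʳ++ Z l (refl X≋Y) = deck-resp-≋ l (ʳ++⁺ (≋-refl {x = Z}) X≋Y)
  deck-resp-ʳ++ Z l (prep {x = x} x≈y p) = trans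
    (deck-resp-ʳ++ (x ∷ Z) l p)
    (deck-resp-≋ (≡.trans (≡.sym (length-ʳ++-↭ Z (↭-prep x p))) l)
      (ʳ++⁺ (≋-refl {x = Z}) (x≈y ∷ ≋-refl)))
  deck-resp-ʳ++ Z l (swap {ys = Y} {x = x} {y = y} x≈x′ y≈y′ p) = trans
    -- Permute the tail, then transpose `x` and `y`, then replace them by equal elements.
    (deck-resp-ʳ++ (y ∷ x ∷ Z) l p) (trans
    (deck-swap x y Y Z (suc-injective (suc-injective (≡.trans
      (≡.trans (+-comm (2 +ℕ length Y) (length Z)) (≡.sym (length-ʳ++ Z)))
      (≡.trans (≡.sym (length-ʳ++-↭ Z (↭-prep x (↭-prep y p)))) l)))))
    (deck-resp-≋ (≡.trans (≡.sym (length-ʳ++-↭ Z (↭-swap x y p))) l)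
      (ʳ++⁺ (≋-refl {x = Z}) (y≈y′ ∷ x≈x′ ∷ ≋-refl))))
  deck-resp-ʳ++ Z l (trans p q) = trans
    (deck-resp-ʳ++ Z l p)
    (deck-resp-ʳ++ Z (≡.trans (≡.sym (length-ʳ++-↭ Z p)) l) q)

  deck-resp : length X ≡ 4 → X ↭ Y → deck X ≈ₘₘ deck Y
  deck-resp = deck-resp-ʳ++ []

  -- Counting the entries of all cards

  sums : Multiset → Multiset
  sums []      = []
  sums (x ∷ X) = map (x +_) X ++ sums X

  length-sums : ∀ X → length X ≡ 4 → length (sums X) ≡ 6
  length-sums (_ ∷ _ ∷ _ ∷ _ ∷ []) _ = ≡.refl

  -- An element survives unmerged in the three cards whose pair avoids it, and each card contributes
  -- one sum.
  concat-deck : ∀ X → length X ≡ 4 → concat (deck X) ↭ triple setoid X ++ sums X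
  concat-deck (a ∷ b ∷ c ∷ d ∷ []) _ =
    Solver.solve 10 (λ a b c d ab ac ad bc bd cd →
      ab ⊕ c ⊕ d ⊕ ac ⊕ b ⊕ d ⊕ ad ⊕ b ⊕ c ⊕ bc ⊕ a ⊕ d ⊕ bd ⊕ a ⊕ c ⊕ cd ⊕ a ⊕ b ⊜
      a ⊕ b ⊕ c ⊕ d ⊕ a ⊕ b ⊕ c ⊕ d ⊕ a ⊕ b ⊕ c ⊕ d ⊕ ab ⊕ ac ⊕ ad ⊕ bc ⊕ bd ⊕ cd)
      ↭-refl (a ∷ []) (b ∷ []) (c ∷ []) (d ∷ []) (a + b ∷ []) (a + c ∷ []) (a + d ∷ [])
      (b + c ∷ []) (b + d ∷ []) (c + d ∷ [])
    where open Solver using (_⊕_; _⊜_)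

  surplus : ∀ D E C → length (D ++ C) ≡ 4 → length (E ++ C) ≡ 4 →
    deck (D ++ C) ≈ₘₘ deck (E ++ C) →
    triple setoid D ++ sums (D ++ C) ↭ triple setoid E ++ sums (E ++ C)
  surplus D E C l l′ p = triple-cancel setoid D E C
    (trans (↭-sym (concat-deck (D ++ C) l)) (trans (concat⁺ setoid p) (concat-deck (E ++ C) l′)))

  -- Cyclic orders of three elements

  Cyclic : ∣G∣ → ∣G∣ → ∣G∣ → Set ℓ
  Cyclic r s t = (r + s ≈ s) × (s + t ≈ t) × (t + r ≈ r)

  -- A transitive tournament on r, s, t would repeat one of the three sums, which
  -- identifies its top with its bottom and so allows that edge to be reversed.
  sums↭⇒cyclic :
    (r + s ≈ r) ⊎ (r + s ≈ s) → (r + t ≈ r) ⊎ (r + t ≈ t) → (s + t ≈ s) ⊎ (s + t ≈ t) →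
    r + s ∷ r + t ∷ s + t ∷ [] ↭ r ∷ s ∷ t ∷ [] → Cyclic r s t ⊎ Cyclic s r t
  sums↭⇒cyclic {r} {s} {t} rs rt st p = go rs rt st
    where
    _∙_ = ≈-trans
    Goal = Cyclic r s t ⊎ Cyclic s r t

    clockwise : r + s ≈ s → r + t ≈ r → s + t ≈ t → Goal
    clockwise rs rt st = inj₁ (rs , st , (comm t r ∙ rt))

    anticlockwise : r + s ≈ r → r + t ≈ t → s + t ≈ s → Goal
    anticlockwise rs rt st = inj₂ ((comm s r ∙ rs) , rt , (comm t s ∙ st))

    sums↭ : r + s ≈ x → r + t ≈ y → s + t ≈ z → x ∷ y ∷ z ∷ [] ↭ r ∷ s ∷ t ∷ []
    sums↭ e₁ e₂ e₃ = trans (refl (≈-sym e₁ ∷ ≈-sym e₂ ∷ ≈-sym e₃ ∷ [])) p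

    go : (r + s ≈ r) ⊎ (r + s ≈ s) → (r + t ≈ r) ⊎ (r + t ≈ t) → (s + t ≈ s) ⊎ (s + t ≈ t) → Goal
    go (inj₂ e₁) (inj₁ e₂) (inj₂ e₃) = clockwise e₁ e₂ e₃
    go (inj₁ e₁) (inj₂ e₂) (inj₁ e₃) = anticlockwise e₁ e₂ e₃
    go (inj₂ e₁) (inj₁ e₂) (inj₁ e₃) = clockwise e₁ e₂ (e₃ ∙ s≈t)
      where s≈t = [x]↭[y]⇒x≈y setoid (drop-∷ (dropMiddleElement (s ∷ []) [] (sums↭ e₁ e₂ e₃)))
    go (inj₂ e₁) (inj₂ e₂) (inj₁ e₃) = anticlockwise (e₁ ∙ s≈r) e₂ e₃
      where s≈r = [x]↭[y]⇒x≈y setoid (dropMiddleElement [] (r ∷ [])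
                    (dropMiddleElement (s ∷ []) (r ∷ s ∷ []) (sums↭ e₁ e₂ e₃)))
    go (inj₂ e₁) (inj₂ e₂) (inj₂ e₃) = clockwise e₁ (e₂ ∙ t≈r) e₃
      where t≈r = [x]↭[y]⇒x≈y setoid (dropMiddleElement [] (r ∷ [])
                    (dropMiddleElement (s ∷ t ∷ []) (r ∷ s ∷ []) (sums↭ e₁ e₂ e₃)))
    go (inj₁ e₁) (inj₁ e₂) (inj₁ e₃) = anticlockwise e₁ (e₂ ∙ r≈t) e₃
      where r≈t = [x]↭[y]⇒x≈y setoid (dropMiddleElement (r ∷ []) [] (drop-∷ (sums↭ e₁ e₂ e₃)))
    go (inj₁ e₁) (inj₁ e₂) (inj₂ e₃) = clockwise (e₁ ∙ r≈s) e₂ e₃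
      where r≈s = [x]↭[y]⇒x≈y setoid (dropMiddleElement (r ∷ []) (s ∷ []) (drop-∷ (sums↭ e₁ e₂ e₃)))
    go (inj₁ e₁) (inj₂ e₂) (inj₂ e₃) = anticlockwise e₁ e₂ (e₃ ∙ t≈s)
      where t≈s = [x]↭[y]⇒x≈y setoid (dropMiddleElement (t ∷ []) (s ∷ []) (drop-∷ (sums↭ e₁ e₂ e₃)))

  -- The multisets A and B of the introduction.
  merged dropped : ∣G∣ → ∣G∣ → ∣G∣ → MultisetOfMs
  merged  r s t = (r + s ∷ t ∷ []) ∷ (r + t ∷ s ∷ []) ∷ (s + t ∷ r ∷ []) ∷ []
  dropped r s t = (s ∷ t ∷ []) ∷ (r ∷ t ∷ []) ∷ (r ∷ s ∷ []) ∷ []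

  merged↭dropped⇒cyclic : merged r s t Ms.↭ dropped r s t → Cyclic r s t ⊎ Cyclic s r t
  merged↭dropped⇒cyclic {r} {s} {t} p = sums↭⇒cyclic
    (absorbs ↭-refl (here ↭-refl))
    (absorbs (↭-prep r (↭-swap t s ↭-refl)) (there (here ↭-refl)))
    (absorbs (trans (↭-prep s (↭-swap t r ↭-refl)) (↭-swap s r ↭-refl)) (there (there (here ↭-refl))))
    sums↭
    where
    open Membership multisets using () renaming (_∈_ to _∈ₘ_)
    open Solver using (_⊕_; _⊜_)

    complement : X ∈ₘ dropped r s t → ∃[ o ] o ∷ X ↭ r ∷ s ∷ t ∷ []
    complement (here X↭)                 = r , ↭-prep r X↭
    complement (there (here X↭))         = s , trans (↭-prep s X↭) (↭-swap s r ↭-refl)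
    complement (there (there (here X↭))) = t , trans (↭-prep t X↭) (++-comm (t ∷ []) (r ∷ s ∷ []))

    -- The card ⟨x+y, z⟩ occurs in B, so some `o` completes it to ⟨r,s,t⟩ = ⟨x,y,z⟩. Cancelling `z`
    -- leaves x+y in ⟨x,y⟩.
    absorbs : x ∷ y ∷ z ∷ [] ↭ r ∷ s ∷ t ∷ [] → (x + y ∷ z ∷ []) ∈ₘ merged r s t →
      (x + y ≈ x) ⊎ (x + y ≈ y)
    absorbs {x} {y} {z} xyz↭rst ∈merged
      with o , p′ ← complement (Msₚ.∈-resp-↭ p ∈merged)
      with ∈-resp-↭ (dropMiddleElement (o ∷ x + y ∷ []) (x ∷ y ∷ []) (trans p′ (↭-sym xyz↭rst)))
             (there (here ≈-refl))
    ... | here e         = inj₁ e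
    ... | there (here e) = inj₂ e

    -- Flattening A = B gives the three sums together with r, s, t on one side and each of r, s, t
    -- twice on the other.
    sums↭ : r + s ∷ r + t ∷ s + t ∷ [] ↭ r ∷ s ∷ t ∷ []
    sums↭ = dropMiddle {vs = r ∷ s ∷ t ∷ []} (r + s ∷ r + t ∷ s + t ∷ []) (r ∷ s ∷ t ∷ []) (trans
      (Solver.solve 6 (λ r s t rs rt st →
        rs ⊕ rt ⊕ st ⊕ r ⊕ s ⊕ t ⊜ rs ⊕ t ⊕ rt ⊕ s ⊕ st ⊕ r) ↭-refl
        (r ∷ []) (s ∷ []) (t ∷ []) (r + s ∷ []) (r + t ∷ []) (s + t ∷ [])) (trans
      (concat⁺ setoid p)
      (Solver.solve 3 (λ r s t → s ⊕ t ⊕ r ⊕ t ⊕ r ⊕ s ⊜ r ⊕ s ⊕ t ⊕ r ⊕ s ⊕ t) ↭-refl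
        (r ∷ []) (s ∷ []) (t ∷ []))))

  cyclic⇒merged↭dropped : Cyclic r s t → merged r s t Ms.↭ dropped r s t
  cyclic⇒merged↭dropped {r} {s} {t} (rs , st , tr) = prep (prep rs ↭-refl) (swap
    (prep (≈-trans (comm r t) tr) ↭-refl)
    (trans (prep st ↭-refl) (↭-swap t r ↭-refl)) Ms.↭-refl)

  -- The three cards that merge `u` contain `v` in its place; the other three keep `u`.
  deck-exchange : All (λ x → x + u ≈ v) (r ∷ s ∷ t ∷ []) →
    deck (u ∷ r ∷ s ∷ t ∷ []) ≈ₘₘ map (v ∷_) (dropped r s t) ++ map (u ∷_) (merged r s t)
  deck-exchange {u} {v} (ru ∷ su ∷ tu ∷ []) =
    prep (flip ru) (prep (flip su) (prep (flip tu)
    (prep (↭-swap _ u ↭-refl) (prep (↭-swap _ u ↭-refl) (prep (↭-swap _ u ↭-refl) Ms.↭-refl)))))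
    where
    flip : x + u ≈ v → u + x ∷ X ↭ v ∷ X
    flip {x} e = prep (≈-trans (comm u x) e) ↭-refl

  -- Exceptional pairs have equal decks

  Exceptional : Multiset → Multiset → Set _
  Exceptional M M′ = ∃[ r ] ∃[ s ] ∃[ t ] ∃[ u ] ∃[ v ]
    (M ≈ₘ (r ∷ s ∷ t ∷ u ∷ [])) × (M′ ≈ₘ (r ∷ s ∷ t ∷ v ∷ []))
    × All (λ x → (x + u ≈ v) × (x + v ≈ u)) (r ∷ s ∷ t ∷ [])
    × (r + s ≈ s) × (s + t ≈ t) × (t + r ≈ r)

  -- With `u` and `v` moved to the front the decks are v·B ⊎ u·A and u·B ⊎ v·A, which agree because
  -- the cyclic order gives A = B.
  exceptional⇒deck : ∀ {M M′} → length M ≡ 4 → length M′ ≡ 4 → Exceptional M M′ → deck M ≈ₘₘ deck M′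
  exceptional⇒deck l l′ (r , s , t , u , v , p , p′ , uv , cyc) =
    trans (deck-resp l (trans p (last-first u)))
    (trans (deck-exchange (All.map proj₁ uv))
    (trans (Msₚ.++-comm (map (v ∷_) (dropped r s t)) (map (u ∷_) (merged r s t)))
    (trans (Msₚ.++⁺ (map-∷⁺ setoid u A↭B) (map-∷⁺ setoid v (Ms.↭-sym A↭B)))
    (Ms.↭-sym (trans (deck-resp l′ (trans p′ (last-first v))) (deck-exchange (All.map proj₂ uv)))))))
    where
    A↭B = cyclic⇒merged↭dropped cyc

    last-first : ∀ x → r ∷ s ∷ t ∷ x ∷ [] ↭ x ∷ r ∷ s ∷ t ∷ []
    last-first x = ++-comm (r ∷ s ∷ t ∷ []) (x ∷ [])

  -- Case analysis by the size of the difference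

  differ-in-one : ∀ u v r s t → let C = r ∷ s ∷ t ∷ [] in
    Disjoint setoid Q (u ∷ []) (v ∷ []) → deck (u ∷ C) ≈ₘₘ deck (v ∷ C) →
    (Exceptional (u ∷ C) (v ∷ C) → Q) → Q
  differ-in-one u v r s t d p k =
    disjoint-split setoid (triple setoid (u ∷ []))
      (λ x∈ x∈′ → d (∈-triple⁻ setoid (u ∷ []) x∈) (∈-triple⁻ setoid (v ∷ []) x∈′))
      -- The sums within `C` occur on both sides; without them three copies of `u` must lie among
      -- the sums of `v` with `C`.
      (dropMiddle {vs = sums C} (triple setoid (u ∷ []) ++ map (u +_) C)
                                (triple setoid (v ∷ []) ++ map (v +_) C)
                                (surplus (u ∷ []) (v ∷ []) C ≡.refl ≡.refl p))
    λ W v+C↭ u+C↭ →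
    exchange-cancel setoid (dropped r s t) (merged r s t)
      (λ v≈u → d (here ≈-refl) (here (≈-sym v≈u)))
      (trans (Ms.↭-sym (deck-exchange (proj₁ (sums-constant W v+C↭ u+C↭))))
      (trans p
      (trans (deck-exchange (proj₂ (sums-constant W v+C↭ u+C↭)))
             (Msₚ.++-comm (map (u ∷_) (dropped r s t)) (map (v ∷_) (merged r s t))))))
    λ B↭A →
    k (exceptional (All.zip (sums-constant W v+C↭ u+C↭)) (merged↭dropped⇒cyclic (Ms.↭-sym B↭A)))
    where
    C = r ∷ s ∷ t ∷ []

    constant : ∀ x y → map (x +_) C ↭ triple setoid (y ∷ []) → All (λ z → z + x ≈ y) C
    constant x y p with xr ∷ xs ∷ xt ∷ [] ← All-resp-↭ (λ e → ≈-trans (≈-sym e))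
                          (↭-sym p) (≈-refl {y} ∷ ≈-refl ∷ ≈-refl ∷ []) =
      ≈-trans (comm r x) xr ∷ ≈-trans (comm s x) xs ∷ ≈-trans (comm t x) xt ∷ []

    sums-constant : ∀ W →
      map (v +_) C ↭ triple setoid (u ∷ []) ++ W → map (u +_) C ↭ triple setoid (v ∷ []) ++ W →
      All (λ x → x + u ≈ v) C × All (λ x → x + v ≈ u) C
    sums-constant W v+C↭ u+C↭ with ≡.refl ← ++-absorb setoid W ≡.refl v+C↭ =
      constant u v u+C↭ , constant v u v+C↭

    exceptional : All (λ x → (x + u ≈ v) × (x + v ≈ u)) C → Cyclic r s t ⊎ Cyclic s r t →
      Exceptional (u ∷ C) (v ∷ C)
    exceptional e (inj₁ cyc) =
      r , s , t , u , v , ++-comm (u ∷ []) C , ++-comm (v ∷ []) C , e , cyc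
    -- The opposite orientation becomes the required one when `s` is listed before `r`.
    exceptional (er ∷ es ∷ et ∷ []) (inj₂ cyc) =
      s , r , t , u , v ,
      trans (++-comm (u ∷ []) C) (↭-swap r s ↭-refl) ,
      trans (++-comm (v ∷ []) C) (↭-swap r s ↭-refl) , (es ∷ er ∷ et ∷ []) , cyc

  -- The tripled `D` and `E` are disjoint as well, so each has to be supplied by the six sums of the
  -- other side.
  sums-split : ∀ D E C → length (D ++ C) ≡ 4 → length (E ++ C) ≡ 4 →
    Disjoint setoid Q D E → deck (D ++ C) ≈ₘₘ deck (E ++ C) →
    (∀ W → sums (E ++ C) ↭ triple setoid D ++ W → sums (D ++ C) ↭ triple setoid E ++ W → Q) → Q
  sums-split D E C l l′ d p = disjoint-split setoid (triple setoid D)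
    (λ x∈ x∈′ → d (∈-triple⁻ setoid D x∈) (∈-triple⁻ setoid E x∈′))
    (surplus D E C l l′ p)

  differ-in-two : ∀ x y x′ y′ r s → let C = r ∷ s ∷ [] in
    Disjoint setoid Q (x ∷ y ∷ []) (x′ ∷ y′ ∷ []) → deck (x ∷ y ∷ C) ≈ₘₘ deck (x′ ∷ y′ ∷ C) → Q
  differ-in-two {Q = Q} x y x′ y′ r s d p =
    sums-split D E (r ∷ s ∷ []) ≡.refl ≡.refl d p r+s∈both
    where
    D = x ∷ y ∷ []
    E = x′ ∷ y′ ∷ []

    r+s-last : ∀ {a b c d e} → r + s ∈ a ∷ b ∷ c ∷ d ∷ e ∷ r + s ∷ []
    r+s-last = there (there (there (there (there (here ≈-refl)))))

    r+s∈both : ∀ W → sums (x′ ∷ y′ ∷ r ∷ s ∷ []) ↭ triple setoid D ++ W →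
      sums (x ∷ y ∷ r ∷ s ∷ []) ↭ triple setoid E ++ W → Q
    -- Six sums are exhausted by the six elements of `triple D`, so `W` is empty and r+s lies in
    -- both `D` and `E`.
    r+s∈both W E+C↭ D+C↭ with ≡.refl ← ++-absorb setoid W ≡.refl E+C↭ =
      d (∈-triple⁻ setoid D (∈-resp-↭ E+C↭ r+s-last)) (∈-triple⁻ setoid E (∈-resp-↭ D+C↭ r+s-last))

  differ : ∀ D E C → length D ≡ length E → length (D ++ C) ≡ 4 → length (E ++ C) ≡ 4 →
    Disjoint setoid Q D E → deck (D ++ C) ≈ₘₘ deck (E ++ C) →
    (D ++ C ≈ₘ E ++ C ⊎ Exceptional (D ++ C) (E ++ C) → Q) → Q
  differ [] [] _ _ _ _ _ _ k = k (inj₁ ↭-refl)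
  differ (u ∷ []) (v ∷ []) (r ∷ s ∷ t ∷ []) _ _ _ d p k = differ-in-one u v r s t d p (k ∘ inj₂)
  differ (x ∷ y ∷ []) (x′ ∷ y′ ∷ []) (r ∷ s ∷ []) _ _ _ d p _ = differ-in-two x y x′ y′ r s d p
  -- Six sums cannot contain `triple D`, which has nine elements here and twelve in the last case.
  differ D@(_ ∷ _ ∷ _ ∷ []) E C@(_ ∷ []) _ l l′ d p _ = sums-split D E C l l′ d p λ _ E+C↭ _ →
    contradiction (≡.trans (≡.sym (length-sums (E ++ C) l′)) (xs↭ys⇒|xs|≡|ys| E+C↭)) λ ()
  differ D@(_ ∷ _ ∷ _ ∷ _ ∷ []) E [] _ l l′ d p _ = sums-split D E [] l l′ d p λ _ E+C↭ _ →
    contradiction (≡.trans (≡.sym (length-sums (E ++ []) l′)) (xs↭ys⇒|xs|≡|ys| E+C↭)) λ ()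

  deck⇒equal⊎exceptional : ∀ {M M′} → length M ≡ 4 → length M′ ≡ 4 → deck M ≈ₘₘ deck M′ →
    M ≈ₘ M′ ⊎ Exceptional M M′
  -- `Q` is now the disjunction to be proved, so every relative refutation ends in the goal.
  deck⇒equal⊎exceptional {M} {M′} l l′ p = commonPart setoid M M′ λ C D E M↭ M′↭ d →
    let |D++C| = ≡.trans (≡.sym (xs↭ys⇒|xs|≡|ys| M↭)) l
        |E++C| = ≡.trans (≡.sym (xs↭ys⇒|xs|≡|ys| M′↭)) l′
        |D|≡|E| = +-cancelʳ-≡ (length C) (length D) (length E)
          (≡.trans (≡.sym (length-++ D)) (≡.trans |D++C| (≡.trans (≡.sym |E++C|) (length-++ E))))
    in differ D E C |D|≡|E| |D++C| |E++C| d
         (trans (Ms.↭-sym (deck-resp l M↭)) (trans p (deck-resp l′ M′↭)))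
    λ where
      (inj₁ q) → inj₁ (trans M↭ (trans q (↭-sym M′↭)))
      (inj₂ (r , s , t , u , v , q , q′ , e)) →
        inj₂ (r , s , t , u , v , trans M↭ q , trans M′↭ q′ , e)

mainTheorem4 : ∀ {c ℓ} (G : CommutativeMagma c ℓ) → let open Deck G in
    (M M′ : Multiset) → length M ≡ 4 → length M′ ≡ 4 →
    (deck M ≈ₘₘ deck M′) ⇔
      (M ≈ₘ M′
       ⊎ (∃[ r ] ∃[ s ] ∃[ t ] ∃[ u ] ∃[ v ]
            (M ≈ₘ (r ∷ s ∷ t ∷ u ∷ []))
            × (M′ ≈ₘ (r ∷ s ∷ t ∷ v ∷ []))
            × All (λ x → (x + u ≈ v) × (x + v ≈ u)) (r ∷ s ∷ t ∷ [])
            × (r + s ≈ s) × (s + t ≈ t) × (t + r ≈ r)))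
mainTheorem4 G M M′ l l′ = mk⇔ (deck⇒equal⊎exceptional G l l′) λ where
  (inj₁ M↭M′) → deck-resp G l M↭M′
  (inj₂ e)    → exceptional⇒deck G l l′ e
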